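{- Let $H$ be a grid subgraph on $r$ rows and $c$ columns which can be obtained (up to relabeling rows and columns) by finitely many row/column-bridging operations starting from the grid subgraph consisting of a single vertex (one row, one column, no edges). Then $\operatorname{gr}(H,K_k)=k^{O(2^{r+c})}$; explicitly, $\operatorname{gr}(H,K_k)\le 2^{2^{r+c}-2}k^{2^{r+c-3}}$ for all $k\ge 1$.
   Context: A grid subgraph on $c$ columns and $r$ rows is a graph whose vertex set is a subset of $[c]\times[r]$ (vertex $(x,y)$ in column $x$, row $y$) and whose edges each join two vertices in the same row or in the same column. $G_{N\times N}=K_N\square K_N$; a spanning grid subgraph is a spanning subgraph of it. An embedding of $H$ (on $c_H$ columns, $r_H$ rows) into $G$ is a pair of injections $\varphi_c:[c_H]\to[c_G]$, $\varphi_r:[r_H]\to[r_G]$ sending every edge $\{(x,y),(x',y')\}$ of $H$ to an edge $\{(\varphi_c(x),\varphi_r(y)),(\varphi_c(x'),\varphi_r(y'))\}$ of $G$; $G$ contains $H$ if one exists. A coclique of size $k$ is a set of $k$ pairwise non-adjacent vertices all in one row or all in one column. $\operatorname{gr}(H,K_k)$ is the least $N$ such that every spanning grid subgraph of $G_{N\times N}$ contains $H$ or a coclique of size $k$. Column-bridging: for $H$ on $c$ columns and $r$ rows, $c_*\in[c]$, $y\in[r]$, bridging column $c_*$ at row $y$ yields $H'$ on $c+1$ columns and $r$ rows with edges: all edges of $H$; $\{(a,b),(c+1,b)\}$ whenever $\{(a,b),(c_*,b)\}\in E(H)$; $\{(c+1,b),(c+1,e)\}$ whenever $\{(c_*,b),(c_*,e)\}\in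 E(H)$; and $\{(c_*,y),(c+1,y)\}$. Row-bridging is defined analogously with rows and columns exchanged. -}

module Defs where

open import Data.Nat using (ℕ; zero; suc; _+_; _*_; _∸_; _^_; _≤_)
open import Data.Fin using (Fin; zero; suc)
open import Data.Fin.Properties using (_≟_)
open import Data.Fin.Permutation using (Permutation′; _⟨$⟩ʳ_)
open import Data.Bool using (Bool; true; false; _∧_; _∨_)
open import Data.Maybe using (Maybe; just; nothing)
import Data.Maybe as Maybe
open import Data.Product using (Σ; ∃; ∃-syntax; _×_; _,_)
open import Data.Sum using (_⊎_)
open import Function.Definitions using (Injective)
open import Relation.Nullary.Decidable using (⌊_⌋)
open import Relation.Binary.PropositionalEquality using (_≡_; _≢_)

-- A grid subgraph on c columns and r rows.  Vertex (x , y) lies in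
-- column x and row y.  Only the edge set matters for embeddings and
-- cocliques, so a grid subgraph is given by a symmetric,
-- loopless, Bool-valued adjacency relation whose edges join vertices in
-- the same row or the same column.
record GridGraph (c r : ℕ) : Set where
  field
    adj       : Fin c → Fin r → Fin c → Fin r → Bool
    adj-sym   : ∀ x y x' y' → adj x y x' y' ≡ adj x' y' x y
    adj-loop  : ∀ x y → adj x y x y ≡ false
    adj-grid  : ∀ x y x' y' → adj x y x' y' ≡ true → (x ≡ x') ⊎ (y ≡ y')
open GridGraph public

record Embedding {cH rH cG rG : ℕ} (H : GridGraph cH rH) (G : GridGraph cG rG) : Set where
  field
    φc     : Fin cH → Fin cG
    φr     : Fin rH → Fin rG
    φc-inj : Injective _≡_ _≡_ φc
    φr-inj : Injective _≡_ _≡_ φr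
    edges  : ∀ x y x' y' → adj H x y x' y' ≡ true →
             adj G (φc x) (φr y) (φc x') (φr y') ≡ true

Contains : ∀ {cG rG cH rH} → GridGraph cG rG → GridGraph cH rH → Set
Contains G H = Embedding H G

-- A coclique of size k in a spanning grid subgraph of G_{N×N} (all N²
-- vertices present): k distinct, pairwise non-adjacent vertices lying
-- all in one row or all in one column.
HasCoclique : ∀ {N} → GridGraph N N → ℕ → Set
HasCoclique {N} G k =
    (Σ (Fin N) λ y → Σ (Fin k → Fin N) λ f → Injective _≡_ _≡_ f ×
       (∀ i j → i ≢ j → adj G (f i) y (f j) y ≡ false))
  ⊎ (Σ (Fin N) λ x → Σ (Fin k → Fin N) λ f → Injective _≡_ _≡_ f ×
       (∀ i j → i ≢ j → adj G x (f i) x (f j) ≡ false))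

GrProperty : ∀ {c r} → GridGraph c r → ℕ → ℕ → Set
GrProperty H k N = (G : GridGraph N N) → Contains G H ⊎ HasCoclique G k

-- Split Fin (suc n) into the old indices (just i, i : Fin n, embedded
-- as the same number) and the new last index n (nothing).
fromLast : ∀ {n} → Fin (suc n) → Maybe (Fin n)
fromLast {zero}  zero    = nothing
fromLast {suc n} zero    = just zero
fromLast {suc n} (suc i) = Maybe.map suc (fromLast i)

_==_ : ∀ {n} → Fin n → Fin n → Bool
i == j = ⌊ i ≟ j ⌋

-- Bridging column c* at row y of an adjacency A on c columns, r rows;
-- the new column is the last one (index c).
colBridgeAdj : ∀ {c r} → (Fin c → Fin r → Fin c → Fin r → Bool) →
               Fin c → Fin r → Fin (suc c) → Fin r → Fin (suc c) → Fin r → Bool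
colBridgeAdj {c} {r} A cs y x b x' b' = go (fromLast x) (fromLast x')
  where
  go : Maybe (Fin c) → Maybe (Fin c) → Bool
  go (just a) (just a') = A a b a' b'
  go (just a) nothing   = ((b == b') ∧ A a b cs b) ∨ ((a == cs) ∧ (b == y) ∧ (b' == y))
  go nothing  (just a') = ((b == b') ∧ A a' b' cs b') ∨ ((a' == cs) ∧ (b == y) ∧ (b' == y))
  go nothing  nothing   = A cs b cs b'

-- Bridging row r* at column x (rows and columns exchanged); the new row
-- is the last one (index r).
rowBridgeAdj : ∀ {c r} → (Fin c → Fin r → Fin c → Fin r → Bool) →
               Fin r → Fin c → Fin c → Fin (suc r) → Fin c → Fin (suc r) → Bool
rowBridgeAdj {c} {r} A rs x a y a' y' = go (fromLast y) (fromLast y')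
  where
  go : Maybe (Fin r) → Maybe (Fin r) → Bool
  go (just b) (just b') = A a b a' b'
  go (just b) nothing   = ((a == a') ∧ A a b a rs) ∨ ((b == rs) ∧ (a == x) ∧ (a' == x))
  go nothing  (just b') = ((a == a') ∧ A a' b' a' rs) ∨ ((b' == rs) ∧ (a == x) ∧ (a' == x))
  go nothing  nothing   = A a rs a' rs

data Bridged : ℕ → ℕ → Set where
  single : Bridged 1 1
  colBr  : ∀ {c r} → Bridged c r → (cs : Fin c) → (y : Fin r) → Bridged (suc c) r
  rowBr  : ∀ {c r} → Bridged c r → (rs : Fin r) → (x : Fin c) → Bridged c (suc r)

bAdj : ∀ {c r} → Bridged c r → Fin c → Fin r → Fin c → Fin r → Bool
bAdj single            _ _ _ _ = false
bAdj (colBr B cs y)    = colBridgeAdj (bAdj B) cs y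
bAdj (rowBr B rs x)    = rowBridgeAdj (bAdj B) rs x

RelabelOf : ∀ {c r} → GridGraph c r → Bridged c r → Permutation′ c → Permutation′ r → Set
RelabelOf H B σ τ = ∀ x y x' y' →
  adj H x y x' y' ≡ bAdj B (σ ⟨$⟩ʳ x) (τ ⟨$⟩ʳ y) (σ ⟨$⟩ʳ x') (τ ⟨$⟩ʳ y')

{-# OPTIONS --safe #-}
module Submission where

-- Count the embeddings of H among all N^c * N^r placements of its columns and
-- rows.  Fix the images of all rows and of all columns but c*, and let S be the
-- set of columns completing this to an embedding of H.  Two columns of S that
-- are adjacent in the row of y give an embedding of the bridged graph, and
-- deleting closed neighbourhoods greedily shows that, absent a coclique of size
-- k, S spans at least j|S| - k j² ordered adjacent pairs for every j.  Summing
-- with j = δN / 2k, where δ is the density of embeddings and δN the average of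
-- |S|, the density after bridging is at least δ² / 4k.  For the last bridging it
-- only matters that the count is positive, for which δN ≥ 4k before it suffices;
-- this holds for N = (4k)^(2^(r+c-3)).

open import Defs
open import Data.Nat using (ℕ; zero; suc; _+_; _*_; _∸_; _^_; _≤_; _<_; _<?_; z≤n; s≤s; NonZero)
open import Data.Nat.Properties hiding (_≟_; _<?_; suc-injective; 0≢1+n)
open import Data.Nat.Tactic.RingSolver using (solve-∀)
open import Data.Fin using (Fin; zero; suc; fromℕ; punchOut)
open import Data.Fin.Properties using (_≟_; all?; any?; suc-injective; 0≢1+n; punchIn-punchOut)
open import Data.Fin.Permutation using (Permutation′; _⟨$⟩ʳ_)
open import Data.Bool using (Bool; true; false; _∧_; _∨_; not)
import Data.Bool.Properties as Bool
open import Data.List using (List; []; _∷_; _++_; map; tabulate; allFin; length; cartesianProductWith)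
open import Data.List.Properties using (length-tabulate)
open import Data.Maybe using (Maybe; just; nothing; maybe)
import Data.Maybe as Maybe
open import Data.Product using (Σ; ∃-syntax; _×_; _,_; proj₁; proj₂)
open import Data.Sum using (_⊎_; inj₁; inj₂; [_,_]′; map₂)
open import Data.Vec using (Vec; []; _∷_; lookup; insertAt)
open import Data.Vec.Properties using (insertAt-lookup; insertAt-punchIn)
open import Function using (_∘_; id)
open import Function.Bundles using (Injection)
open import Function.Definitions using (Injective)
open import Function.Properties.Inverse using (↔⇒↣)
open import Relation.Nullary using (Dec; yes; no; does; contradiction)
open import Relation.Nullary.Decidable using (_×-dec_; _→-dec_; dec-true)
open import Relation.Binary.PropositionalEquality using (_≡_; _≢_; refl; sym; trans; cong; cong₂; subst; subst₂; module ≡-Reasoning)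

private
  variable
    A B C : Set
    c r k m n N : ℕ

-- Finite sums

∑ : List A → (A → ℕ) → ℕ
∑ []       f = 0
∑ (x ∷ xs) f = f x + ∑ xs f

∑-cong : ∀ (xs : List A) {f g} → (∀ x → f x ≡ g x) → ∑ xs f ≡ ∑ xs g
∑-cong []       f≡g = refl
∑-cong (x ∷ xs) f≡g = cong₂ _+_ (f≡g x) (∑-cong xs f≡g)

∑-mono : ∀ (xs : List A) {f g} → (∀ x → f x ≤ g x) → ∑ xs f ≤ ∑ xs g
∑-mono []       f≤g = z≤n
∑-mono (x ∷ xs) f≤g = +-mono-≤ (f≤g x) (∑-mono xs f≤g)

-- The alternative `C` will be the existence of a coclique: one found at any index settles the whole
-- sum; otherwise all the inequalities hold and add up.
∑-mono-⊎ : ∀ (xs : List A) {f g} → (∀ x → C ⊎ f x ≤ g x) → C ⊎ ∑ xs f ≤ ∑ xs g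
∑-mono-⊎ []       f≤g = inj₂ z≤n
∑-mono-⊎ (x ∷ xs) f≤g with f≤g x | ∑-mono-⊎ xs f≤g
... | inj₁ p | _      = inj₁ p
... | inj₂ _ | inj₁ p = inj₁ p
... | inj₂ p | inj₂ q = inj₂ (+-mono-≤ p q)

∑-const : ∀ (xs : List A) a → ∑ xs (λ _ → a) ≡ length xs * a
∑-const []       a = refl
∑-const (x ∷ xs) a = cong (a +_) (∑-const xs a)

∑-distrib-+ : ∀ (xs : List A) f g → ∑ xs (λ x → f x + g x) ≡ ∑ xs f + ∑ xs g
∑-distrib-+ []       f g = refl
∑-distrib-+ (x ∷ xs) f g rewrite ∑-distrib-+ xs f g = interchange (f x) (g x) (∑ xs f) (∑ xs g)
  where
  interchange : ∀ a b c d → (a + b) + (c + d) ≡ (a + c) + (b + d)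
  interchange = solve-∀

*-distribˡ-∑ : ∀ a (xs : List A) f → ∑ xs (λ x → a * f x) ≡ a * ∑ xs f
*-distribˡ-∑ a []       f = sym (*-zeroʳ a)
*-distribˡ-∑ a (x ∷ xs) f rewrite *-distribˡ-∑ a xs f = sym (*-distribˡ-+ a (f x) (∑ xs f))

∑-comm : ∀ (xs : List A) (ys : List B) (f : A → B → ℕ) →
         ∑ xs (λ x → ∑ ys (f x)) ≡ ∑ ys (λ y → ∑ xs (λ x → f x y))
∑-comm []       ys f = sym (trans (∑-const ys 0) (*-zeroʳ (length ys)))
∑-comm (x ∷ xs) ys f rewrite ∑-comm xs ys f = sym (∑-distrib-+ ys (f x) _)

∑-++ : ∀ (xs ys : List A) f → ∑ (xs ++ ys) f ≡ ∑ xs f + ∑ ys f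
∑-++ []       ys f = refl
∑-++ (x ∷ xs) ys f rewrite ∑-++ xs ys f = sym (+-assoc (f x) (∑ xs f) (∑ ys f))

∑-map : ∀ (g : A → B) xs f → ∑ (map g xs) f ≡ ∑ xs (f ∘ g)
∑-map g []       f = refl
∑-map g (x ∷ xs) f = cong (f (g x) +_) (∑-map g xs f)

∑-cartesianProductWith : ∀ (g : A → B → C) xs ys f →
  ∑ (cartesianProductWith g xs ys) f ≡ ∑ xs (λ x → ∑ ys (λ y → f (g x y)))
∑-cartesianProductWith g []       ys f = refl
∑-cartesianProductWith g (x ∷ xs) ys f
  rewrite ∑-++ (map (g x) ys) (cartesianProductWith g xs ys) f
        | ∑-map (g x) ys f
        | ∑-cartesianProductWith g xs ys f = refl

∑-positive : ∀ (xs : List A) f → 0 < ∑ xs f → ∃[ x ] 0 < f x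
∑-positive (x ∷ xs) f 0<∑ with f x in eq
... | suc _ = x , subst (0 <_) (sym eq) (s≤s z≤n)
... | zero  = ∑-positive xs f 0<∑

-- Indicators of Booleans

[_] : Bool → ℕ
[ true  ] = 1
[ false ] = 0

∧-true : ∀ {a b} → a ∧ b ≡ true → a ≡ true × b ≡ true
∧-true {true} {true} _ = refl , refl

does-true : ∀ {P : Set} (p? : Dec P) → does p? ≡ true → P
does-true (yes p) _ = p

[]-mono : ∀ {a b} → (a ≡ true → b ≡ true) → [ a ] ≤ [ b ]
[]-mono {false} _   = z≤n
[]-mono {true}  a⇒b rewrite a⇒b refl = ≤-refl

[]-positive : ∀ {b} → 0 < [ b ] → b ≡ true
[]-positive {true} _ = refl

-- Stated for an arbitrary injection because the tail of `allFin` is tabulated by `suc`, not by the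
-- identity. After a first hit, injectivity makes the remaining terms vanish.
∑-≟-tabulate : ∀ (g : Fin m → Fin n) → Injective _≡_ _≡_ g → ∀ w →
               ∑ (tabulate g) (λ u → [ u == w ]) ≤ 1
∑-≟-tabulate {zero}  g g-inj w = z≤n
∑-≟-tabulate {suc m} {n} g g-inj w with g zero ≟ w
... | no  _    = ∑-≟-tabulate (g ∘ suc) (suc-injective ∘ g-inj) w
... | yes refl = s≤s (≤-reflexive (vanish (g ∘ suc) (λ i eq → 0≢1+n (sym (g-inj eq)))))
  where
  vanish : ∀ {l} (h : Fin l → Fin n) → (∀ i → h i ≢ w) → ∑ (tabulate h) (λ u → [ u == w ]) ≡ 0
  vanish {zero}  h h≢w = refl
  vanish {suc l} h h≢w with h zero ≟ w
  ... | yes p = contradiction p (h≢w zero)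
  ... | no  _ = vanish (h ∘ suc) (h≢w ∘ suc)

∑-≟ : ∀ (w : Fin n) → ∑ (allFin n) (λ u → [ u == w ]) ≤ 1
∑-≟ = ∑-≟-tabulate id id

-- Enumerating placements as vectors

vecs : ∀ N c → List (Vec (Fin N) c)
vecs N zero    = [] ∷ []
vecs N (suc c) = cartesianProductWith _∷_ (allFin N) (vecs N c)

∑-vecs-const : ∀ N c a → ∑ (vecs N c) (λ _ → a) ≡ N ^ c * a
∑-vecs-const N zero    a = refl
∑-vecs-const N (suc c) a = begin
  ∑ (vecs N (suc c)) (λ _ → a)                     ≡⟨ ∑-cartesianProductWith _∷_ (allFin N) (vecs N c) _ ⟩
  ∑ (allFin N) (λ _ → ∑ (vecs N c) (λ _ → a))      ≡⟨ ∑-const (allFin N) _ ⟩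
  length (allFin N) * ∑ (vecs N c) (λ _ → a)       ≡⟨ cong₂ _*_ (length-tabulate {n = N} id) (∑-vecs-const N c a) ⟩
  N * (N ^ c * a)                                  ≡⟨ *-assoc N (N ^ c) a ⟨
  N ^ suc c * a                                    ∎
  where open ≡-Reasoning

-- A placement consists of the image `u` of index `i` and the images `ρ` of the others. The sum over
-- `u` goes innermost, since it is the completions of each fixed `ρ` that get counted.
∑-insertAt : ∀ (i : Fin (suc c)) (f : Vec (Fin N) (suc c) → ℕ) →
  ∑ (vecs N (suc c)) f ≡ ∑ (vecs N c) (λ ρ → ∑ (allFin N) (λ u → f (insertAt ρ i u)))
∑-insertAt {c} {N} zero f =
  trans (∑-cartesianProductWith _∷_ (allFin N) (vecs N c) f) (∑-comm (allFin N) (vecs N c) _)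
∑-insertAt {suc c} {N} (suc i) f = begin
  ∑ (vecs N (2 + c)) f
    ≡⟨ ∑-cartesianProductWith _∷_ (allFin N) (vecs N (suc c)) f ⟩
  ∑ (allFin N) (λ a → ∑ (vecs N (suc c)) (λ φ → f (a ∷ φ)))
    ≡⟨ ∑-cong (allFin N) (λ a → ∑-insertAt i (λ φ → f (a ∷ φ))) ⟩
  ∑ (allFin N) (λ a → ∑ (vecs N c) (λ ρ → ∑ (allFin N) (λ u → f (a ∷ insertAt ρ i u))))
    ≡⟨ ∑-cartesianProductWith _∷_ (allFin N) (vecs N c) _ ⟨
  ∑ (vecs N (suc c)) (λ ρ → ∑ (allFin N) (λ u → f (insertAt ρ (suc i) u))) ∎
  where open ≡-Reasoning

-- Cocliques in a single row

Coclique : (Fin N → Fin N → Bool) → (Fin N → Bool) → ℕ → Set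
Coclique {N} E S k = Σ (Fin k → Fin N) λ f → Injective _≡_ _≡_ f ×
  (∀ i → S (f i) ≡ true) × (∀ i j → i ≢ j → E (f i) (f j) ≡ false)

size : (Fin N → Bool) → ℕ
size {N} S = ∑ (allFin N) (λ u → [ S u ])

degree : (Fin N → Fin N → Bool) → (Fin N → Bool) → Fin N → ℕ
degree {N} E S u = ∑ (allFin N) (λ v → [ S v ∧ E u v ])

adjacentPairs : (Fin N → Fin N → Bool) → (Fin N → Bool) → ℕ
adjacentPairs {N} E S = ∑ (allFin N) (λ u → ∑ (allFin N) (λ v → [ S u ∧ S v ∧ E u v ]))

adjacentPairs-mono : ∀ (E : Fin N → Fin N → Bool) {S S′} → (∀ u → S u ≡ true → S′ u ≡ true) →
                     adjacentPairs E S ≤ adjacentPairs E S′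
adjacentPairs-mono {N} E {S} {S′} S⊆S′ =
  ∑-mono (allFin N) λ u → ∑-mono (allFin N) λ v → []-mono (pair u v)
  where
  pair : ∀ u v → S u ∧ S v ∧ E u v ≡ true → S′ u ∧ S′ v ∧ E u v ≡ true
  pair u v p with ∧-true p
  ... | su , q with ∧-true q
  ... | sv , e rewrite S⊆S′ u su | S⊆S′ v sv | e = refl

-- The closed neighbourhood is deleted, so `v` can be added to any coclique found in what is left.
_∖N[_] : (Fin N → Bool) → (Fin N → Fin N → Bool) → Fin N → Fin N → Bool
(S ∖N[ E ]) v w = S w ∧ not (w == v) ∧ not (E v w)

-- Each element of `S` survives, equals `v`, or is a neighbour counted by `degree E S v`.
size-∖N : ∀ (E : Fin N → Fin N → Bool) S v → size S ≤ size ((S ∖N[ E ]) v) + (1 + degree E S v)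
size-∖N {N} E S v = begin
  size S
    ≤⟨ ∑-mono (allFin N) (λ w → pointwise (S w) (w == v) (E v w)) ⟩
  ∑ (allFin N) (λ w → [ (S ∖N[ E ]) v w ] + ([ w == v ] + [ S w ∧ E v w ]))
    ≡⟨ ∑-distrib-+ (allFin N) _ _ ⟩
  size ((S ∖N[ E ]) v) + ∑ (allFin N) (λ w → [ w == v ] + [ S w ∧ E v w ])
    ≡⟨ cong (size ((S ∖N[ E ]) v) +_) (∑-distrib-+ (allFin N) _ _) ⟩
  size ((S ∖N[ E ]) v) + (∑ (allFin N) (λ w → [ w == v ]) + degree E S v)
    ≤⟨ +-monoʳ-≤ (size ((S ∖N[ E ]) v)) (+-monoˡ-≤ (degree E S v) (∑-≟ v)) ⟩
  size ((S ∖N[ E ]) v) + (1 + degree E S v) ∎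
  where
  open ≤-Reasoning
  pointwise : ∀ s d e → [ s ] ≤ [ s ∧ not d ∧ not e ] + ([ d ] + [ s ∧ e ])
  pointwise false d     e     = z≤n
  pointwise true  true  e     = s≤s z≤n
  pointwise true  false true  = s≤s z≤n
  pointwise true  false false = s≤s z≤n

coclique-∷ : ∀ (E : Fin N → Fin N → Bool) → (∀ u v → E u v ≡ E v u) → ∀ {S v} → S v ≡ true →
             Coclique E ((S ∖N[ E ]) v) k → Coclique E S (suc k)
coclique-∷ {N} {k} E E-sym {S} {v} Sv (f , f-inj , f∈S′ , f-indep) = g , g-inj , g∈S , g-indep
  where
  f∈S : ∀ i → S (f i) ≡ true
  f∈S i = proj₁ (∧-true (f∈S′ i))

  f≢v : ∀ i → f i ≢ v
  f≢v i eq with f i ≟ v | proj₁ (∧-true {not (f i == v)} (proj₂ (∧-true {S (f i)} (f∈S′ i))))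
  ... | no f≢v | _  = f≢v eq
  ... | yes _  | ()

  f-nonadj : ∀ i → E v (f i) ≡ false
  f-nonadj i with E v (f i) | proj₂ (∧-true {not (f i == v)} (proj₂ (∧-true {S (f i)} (f∈S′ i))))
  ... | false | _ = refl

  g : Fin (suc k) → Fin N
  g zero    = v
  g (suc i) = f i

  g-inj : Injective _≡_ _≡_ g
  g-inj {zero}  {zero}  _  = refl
  g-inj {zero}  {suc j} eq = contradiction (sym eq) (f≢v j)
  g-inj {suc i} {zero}  eq = contradiction eq (f≢v i)
  g-inj {suc i} {suc j} eq = cong suc (f-inj eq)

  g∈S : ∀ i → S (g i) ≡ true
  g∈S zero    = Sv
  g∈S (suc i) = f∈S i

  g-indep : ∀ i j → i ≢ j → E (g i) (g j) ≡ false
  g-indep zero    zero    i≢j = contradiction refl i≢j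
  g-indep zero    (suc j) i≢j = f-nonadj j
  g-indep (suc i) zero    i≢j = trans (E-sym (f i) v) (f-nonadj i)
  g-indep (suc i) (suc j) i≢j = f-indep i j (i≢j ∘ cong suc)

-- A linearised Turán bound: either all degrees in S are at least j, or the
-- closed neighbourhood of a vertex of smaller degree can be deleted at the
-- cost of j vertices.
coclique⊎adjacentPairs : ∀ (E : Fin N → Fin N → Bool) → (∀ u v → E u v ≡ E v u) → ∀ k j S →
  Coclique E S k ⊎ j * size S ≤ adjacentPairs E S + k * (j * j)
coclique⊎adjacentPairs E E-sym zero    j S = inj₁ ((λ ()) , (λ { {()} }) , (λ ()) , (λ ()))
coclique⊎adjacentPairs {N} E E-sym (suc k) j S
  with any? (λ v → (S v Bool.≟ true) ×-dec (degree E S v <? j))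
... | no all-large = inj₂ (begin
  j * size S                            ≡⟨ *-distribˡ-∑ j (allFin N) _ ⟨
  ∑ (allFin N) (λ u → j * [ S u ])      ≤⟨ ∑-mono (allFin N) large ⟩
  adjacentPairs E S                     ≤⟨ m≤m+n _ _ ⟩
  adjacentPairs E S + suc k * (j * j)   ∎)
  where
  open ≤-Reasoning
  large : ∀ u → j * [ S u ] ≤ ∑ (allFin N) (λ v → [ S u ∧ S v ∧ E u v ])
  large u with S u in eq
  ... | false = ≤-trans (≤-reflexive (*-zeroʳ j)) z≤n
  ... | true  = ≤-trans (≤-reflexive (*-identityʳ j)) (≮⇒≥ λ deg<j → all-large (u , eq , deg<j))
... | yes (v , Sv , deg<j) with coclique⊎adjacentPairs E E-sym k j ((S ∖N[ E ]) v)
...   | inj₁ coclique = inj₁ (coclique-∷ E E-sym {S} Sv coclique)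
...   | inj₂ bound    = inj₂ (begin
  j * size S                                       ≤⟨ *-monoʳ-≤ j (≤-trans (size-∖N E S v) (+-monoʳ-≤ (size S′) deg<j)) ⟩
  j * (size S′ + j)                                ≡⟨ *-distribˡ-+ j (size S′) j ⟩
  j * size S′ + j * j                              ≤⟨ +-monoˡ-≤ (j * j) bound ⟩
  adjacentPairs E S′ + k * (j * j) + j * j         ≤⟨ +-monoˡ-≤ (j * j) (+-monoˡ-≤ (k * (j * j)) (adjacentPairs-mono E {S′} {S} (λ u → proj₁ ∘ ∧-true))) ⟩
  adjacentPairs E S + k * (j * j) + j * j          ≡⟨ rearrange (adjacentPairs E S) (k * (j * j)) (j * j) ⟩
  adjacentPairs E S + suc k * (j * j)              ∎)
  where
  open ≤-Reasoning
  S′ = (S ∖N[ E ]) v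
  rearrange : ∀ a b d → a + b + d ≡ a + (d + b)
  rearrange = solve-∀

-- Counting embeddings

Adj : ℕ → ℕ → Set
Adj c r = Fin c → Fin r → Fin c → Fin r → Bool

-- Exchanging rows and columns reduces row-bridging to column-bridging.
_ᵀ : Adj c r → Adj r c
(A ᵀ) y x y′ x′ = A x y x′ y′

Distinct : Vec (Fin N) n → Set
Distinct φ = ∀ x x′ → lookup φ x ≡ lookup φ x′ → x ≡ x′

-- Injectivity is part of the predicate, so that counts can range over all placements and be split
-- one coordinate at a time.
IsEmbedding : Adj N N → Adj c r → Vec (Fin N) c → Vec (Fin N) r → Set
IsEmbedding E A φ ψ = Distinct φ × Distinct ψ ×
  (∀ x y x′ y′ → A x y x′ y′ ≡ true → E (lookup φ x) (lookup ψ y) (lookup φ x′) (lookup ψ y′) ≡ true)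

distinct? : (φ : Vec (Fin N) n) → Dec (Distinct φ)
distinct? φ = all? λ x → all? λ x′ → (lookup φ x ≟ lookup φ x′) →-dec (x ≟ x′)

isEmbedding? : ∀ (E : Adj N N) (A : Adj c r) φ ψ → Dec (IsEmbedding E A φ ψ)
isEmbedding? E A φ ψ = distinct? φ ×-dec distinct? ψ ×-dec
  (all? λ x → all? λ y → all? λ x′ → all? λ y′ → (A x y x′ y′ Bool.≟ true) →-dec (_ Bool.≟ true))

count : Adj N N → Adj c r → ℕ
count {N} {c} {r} E A = ∑ (vecs N r) (λ ψ → ∑ (vecs N c) (λ φ → [ does (isEmbedding? E A φ ψ) ]))

count-mono : ∀ (E : Adj N N) {A A′ : Adj c r} →
             (∀ x y x′ y′ → A′ x y x′ y′ ≡ true → A x y x′ y′ ≡ true) → count E A ≤ count E A′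
count-mono {N} {c} {r} E {A} {A′} A′⊆A =
  ∑-mono (vecs N r) λ ψ → ∑-mono (vecs N c) λ φ → []-mono λ emb →
    let (φ-dist , ψ-dist , φψ-edges) = does-true (isEmbedding? E A φ ψ) emb in
    dec-true (isEmbedding? E A′ φ ψ)
      (φ-dist , ψ-dist , λ x y x′ y′ → φψ-edges x y x′ y′ ∘ A′⊆A x y x′ y′)

-- One inequality serves both directions, because transposing twice is definitionally the identity.
count-ᵀ : ∀ (E : Adj N N) (A : Adj c r) → count E A ≤ count (E ᵀ) (A ᵀ)
count-ᵀ {N} {c} {r} E A = ≤-trans (≤-reflexive (∑-comm (vecs N r) (vecs N c) _))
  (∑-mono (vecs N c) λ φ → ∑-mono (vecs N r) λ ψ → []-mono λ emb →
    let (φ-dist , ψ-dist , φψ-edges) = does-true (isEmbedding? E A φ ψ) emb in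
    dec-true (isEmbedding? (E ᵀ) (A ᵀ) ψ φ) (ψ-dist , φ-dist , λ y x y′ x′ → φψ-edges x y x′ y′))

count-positive : ∀ (E : Adj N N) (A : Adj c r) → 0 < count E A →
                 ∃[ φ ] ∃[ ψ ] IsEmbedding E A φ ψ
count-positive {N} {c} {r} E A 0<count =
  let (ψ , 0<∑)   = ∑-positive (vecs N r) _ 0<count
      (φ , 0<ind) = ∑-positive (vecs N c) _ 0<∑
  in  φ , ψ , does-true (isEmbedding? E A φ ψ) ([]-positive 0<ind)

-- Bridging a column

-- Inserting at `fromℕ n` appends the image of the new column. The right side follows `fromLast`,
-- the case split by which `colBridgeAdj` is defined.
lookup-insertAt-last : ∀ (φ : Vec A n) v x →
                       lookup (insertAt φ (fromℕ n) v) x ≡ maybe (lookup φ) v (fromLast x)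
lookup-insertAt-last []      v zero    = refl
lookup-insertAt-last (a ∷ φ) v zero    = refl
lookup-insertAt-last (a ∷ φ) v (suc x) with fromLast x | lookup-insertAt-last φ v x
... | just _  | eq = eq
... | nothing | eq = eq

fromLast-injective : ∀ (x x′ : Fin (suc n)) → fromLast x ≡ fromLast x′ → x ≡ x′
fromLast-injective {zero}  zero    zero     _  = refl
fromLast-injective {suc n} zero    zero     _  = refl
fromLast-injective {suc n} zero    (suc x′) eq with fromLast x′ | eq
... | just _  | ()
... | nothing | ()
fromLast-injective {suc n} (suc x) zero     eq with fromLast x | eq
... | just _  | ()
... | nothing | ()
fromLast-injective {suc n} (suc x) (suc x′) eq =
  cong suc (fromLast-injective x x′ (map-suc-injective (fromLast x) (fromLast x′) eq))
  where
  map-suc-injective : ∀ (p q : Maybe (Fin n)) → Maybe.map suc p ≡ Maybe.map suc q → p ≡ q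
  map-suc-injective (just _) (just _) refl = refl
  map-suc-injective nothing  nothing  _    = refl

insertAt-lookup-≢ : ∀ (ρ : Vec A n) i u v {x} → i ≢ x →
                    lookup (insertAt ρ i u) x ≡ lookup (insertAt ρ i v) x
insertAt-lookup-≢ ρ i u v {x} i≢x = begin
  lookup (insertAt ρ i u) x              ≡⟨ cong (lookup (insertAt ρ i u)) (punchIn-punchOut i≢x) ⟨
  lookup (insertAt ρ i u) _              ≡⟨ insertAt-punchIn ρ i u (punchOut i≢x) ⟩
  lookup ρ (punchOut i≢x)                ≡⟨ insertAt-punchIn ρ i v (punchOut i≢x) ⟨
  lookup (insertAt ρ i v) _              ≡⟨ cong (lookup (insertAt ρ i v)) (punchIn-punchOut i≢x) ⟩
  lookup (insertAt ρ i v) x              ∎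
  where open ≡-Reasoning

==⇒≡ : ∀ (i j : Fin n) → (i == j) ≡ true → i ≡ j
==⇒≡ i j eq with i ≟ j
... | yes i≡j = i≡j

∨-true : ∀ {a b} → a ∨ b ≡ true → a ≡ true ⊎ b ≡ true
∨-true {true}  _ = inj₁ refl
∨-true {false} p = inj₂ p

Symmetric : Adj c r → Set
Symmetric A = ∀ x y x′ y′ → A x y x′ y′ ≡ A x′ y′ x y

Loopless : Adj c r → Set
Loopless A = ∀ x y → A x y x y ≡ false

-- The new column is sent to `v`. Edges copied from `cs` are preserved because `v` completes `ρ` as
-- well as `u` does, and the bridge is the assumed adjacency of `u` and `v` in the row of `y`.
isEmbedding-colBridge : ∀ (E : Adj N N) → Symmetric E → Loopless E →
  ∀ (A : Adj (suc c) r) cs y (ρ : Vec (Fin N) c) ψ u v →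
  IsEmbedding E A (insertAt ρ cs u) ψ → IsEmbedding E A (insertAt ρ cs v) ψ →
  E u (lookup ψ y) v (lookup ψ y) ≡ true →
  IsEmbedding E (colBridgeAdj A cs y) (insertAt (insertAt ρ cs u) (fromℕ (suc c)) v) ψ
isEmbedding-colBridge E E-sym E-loop A cs y ρ ψ u v
                      (u-dist , ψ-dist , u-edges) (v-dist , _ , v-edges) uv-edge =
  distinct , ψ-dist , edge
  where
  φᵤ = insertAt ρ cs u
  φᵥ = insertAt ρ cs v

  no-loop : ∀ {x y} → E x y x y ≢ true
  no-loop {x} {y} eq with trans (sym eq) (E-loop x y)
  ... | ()

  -- At `cs`, equality would make `u` adjacent to itself; at any other column it would contradict
  -- the injectivity of `φᵥ`.
  new≢old : ∀ a → lookup φᵤ a ≢ v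
  new≢old a eq with cs ≟ a
  ... | yes refl = no-loop (subst (λ w → E w _ v _ ≡ true)
                                  (trans (sym (insertAt-lookup ρ cs u)) eq) uv-edge)
  ... | no cs≢a  = cs≢a (v-dist cs a (trans (insertAt-lookup ρ cs v)
                                            (trans (sym eq) (insertAt-lookup-≢ ρ cs u v cs≢a))))

  distinct : Distinct (insertAt φᵤ (fromℕ _) v)
  distinct x x′ eq rewrite lookup-insertAt-last φᵤ v x | lookup-insertAt-last φᵤ v x′
    with fromLast x in p | fromLast x′ in q
  ... | just a  | just a′ = fromLast-injective x x′ (trans p (trans (cong just (u-dist a a′ eq)) (sym q)))
  ... | just a  | nothing = contradiction eq (new≢old a)
  ... | nothing | just a′ = contradiction (sym eq) (new≢old a′)
  ... | nothing | nothing = fromLast-injective x x′ (trans p (sym q))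

  copied : ∀ a b → A a b cs b ≡ true → E (lookup φᵤ a) (lookup ψ b) v (lookup ψ b) ≡ true
  copied a b edge with cs ≟ a
  -- An edge of `A` from a vertex of `cs` to itself would be sent to a loop of `E`.
  ... | yes refl = contradiction (u-edges cs b cs b edge) no-loop
  ... | no cs≢a  = subst₂ (λ s t → E s _ t _ ≡ true)
                          (sym (insertAt-lookup-≢ ρ cs u v cs≢a)) (insertAt-lookup ρ cs v)
                          (v-edges a b cs b edge)

  bridge : E (lookup φᵤ cs) (lookup ψ y) v (lookup ψ y) ≡ true
  bridge = subst (λ w → E w _ v _ ≡ true) (sym (insertAt-lookup ρ cs u)) uv-edge

  edge : ∀ x b x′ b′ → colBridgeAdj A cs y x b x′ b′ ≡ true →
         E (lookup (insertAt φᵤ (fromℕ _) v) x) (lookup ψ b)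
           (lookup (insertAt φᵤ (fromℕ _) v) x′) (lookup ψ b′) ≡ true
  edge x b x′ b′ h rewrite lookup-insertAt-last φᵤ v x | lookup-insertAt-last φᵤ v x′
    with fromLast x | fromLast x′
  ... | just a  | just a′ = u-edges a b a′ b′ h
  ... | nothing | nothing = subst (λ w → E w _ w _ ≡ true) (insertAt-lookup ρ cs v) (v-edges cs b cs b′ h)
  ... | just a  | nothing with ∨-true h
  ...   | inj₁ p with ∧-true p
  ...     | b≡b′ , ab with ==⇒≡ b b′ b≡b′
  ...       | refl = copied a b ab
  edge x b x′ b′ h | just a  | nothing | inj₂ p with ∧-true p
  ...     | a≡cs , q with ∧-true q
  ...       | b≡y , b′≡y with ==⇒≡ a cs a≡cs | ==⇒≡ b y b≡y | ==⇒≡ b′ y b′≡y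
  ...         | refl | refl | refl = bridge
  edge x b x′ b′ h | nothing | just a′ with ∨-true h
  ...   | inj₁ p with ∧-true p
  ...     | b≡b′ , ab with ==⇒≡ b b′ b≡b′
  ...       | refl = trans (E-sym _ _ _ _) (copied a′ b ab)
  edge x b x′ b′ h | nothing | just a′ | inj₂ p with ∧-true p
  ...     | a≡cs , q with ∧-true q
  ...       | b≡y , b′≡y with ==⇒≡ a′ cs a≡cs | ==⇒≡ b y b≡y | ==⇒≡ b′ y b′≡y
  ...         | refl | refl | refl = trans (E-sym _ _ _ _) bridge

-- Counting across one column-bridging

RowCoclique : Adj N N → ℕ → Set
RowCoclique {N} E k = Σ (Fin N) λ y → Σ (Fin k → Fin N) λ f → Injective _≡_ _≡_ f ×
  (∀ i j → i ≢ j → E (f i) y (f j) y ≡ false)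

-- The linearised Turán bound is summed over all images `ψ` of the rows and `ρ` of the columns other
-- than `cs`; the loss `k * (j * j)` is paid once for each such choice.
count-colBridge : ∀ (E : Adj N N) → Symmetric E → Loopless E →
  ∀ k j (A : Adj (suc c) r) cs y →
  RowCoclique E k ⊎
  j * count E A ≤ count E (colBridgeAdj A cs y) + N ^ r * (N ^ c * (k * (j * j)))
count-colBridge {N} {c} {r} E E-sym E-loop k j A cs y =
  map₂ (subst₂ _≤_ lhs rhs) (∑-mono-⊎ (vecs N r) λ ψ → ∑-mono-⊎ (vecs N c) λ ρ → completions ψ ρ)
  where
  A′ = colBridgeAdj A cs y

  S : Vec (Fin N) r → Vec (Fin N) c → Fin N → Bool
  S ψ ρ u = does (isEmbedding? E A (insertAt ρ cs u) ψ)

  pairs : Vec (Fin N) r → Vec (Fin N) c → ℕ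
  pairs ψ ρ = ∑ (allFin N) λ u → ∑ (allFin N) λ v →
    [ does (isEmbedding? E A′ (insertAt (insertAt ρ cs u) (fromℕ (suc c)) v) ψ) ]

  row : Vec (Fin N) r → Fin N → Fin N → Bool
  row ψ u v = E u (lookup ψ y) v (lookup ψ y)

  adjacentPairs≤pairs : ∀ ψ ρ → adjacentPairs (row ψ) (S ψ ρ) ≤ pairs ψ ρ
  adjacentPairs≤pairs ψ ρ = ∑-mono (allFin N) λ u → ∑-mono (allFin N) λ v → []-mono λ p →
    let (u∈S , q)  = ∧-true {S ψ ρ u} p
        (v∈S , uv) = ∧-true {S ψ ρ v} q
    in  dec-true (isEmbedding? E A′ (insertAt (insertAt ρ cs u) (fromℕ (suc c)) v) ψ)
          (isEmbedding-colBridge E E-sym E-loop A cs y ρ ψ u v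
            (does-true (isEmbedding? E A (insertAt ρ cs u) ψ) u∈S)
            (does-true (isEmbedding? E A (insertAt ρ cs v) ψ) v∈S) uv)

  completions : ∀ ψ ρ → RowCoclique E k ⊎ j * size (S ψ ρ) ≤ pairs ψ ρ + k * (j * j)
  completions ψ ρ with coclique⊎adjacentPairs (row ψ) (λ u v → E-sym _ _ _ _) k j (S ψ ρ)
  ... | inj₁ (f , f-inj , _ , f-indep) = inj₁ (lookup ψ y , f , f-inj , f-indep)
  ... | inj₂ bound = inj₂ (≤-trans bound (+-monoˡ-≤ (k * (j * j)) (adjacentPairs≤pairs ψ ρ)))

  open ≡-Reasoning

  lhs : ∑ (vecs N r) (λ ψ → ∑ (vecs N c) (λ ρ → j * size (S ψ ρ))) ≡ j * count E A
  lhs = begin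
    ∑ (vecs N r) (λ ψ → ∑ (vecs N c) (λ ρ → j * size (S ψ ρ)))
      ≡⟨ ∑-cong (vecs N r) (λ ψ → *-distribˡ-∑ j (vecs N c) _) ⟩
    ∑ (vecs N r) (λ ψ → j * ∑ (vecs N c) (λ ρ → size (S ψ ρ)))
      ≡⟨ *-distribˡ-∑ j (vecs N r) _ ⟩
    j * ∑ (vecs N r) (λ ψ → ∑ (vecs N c) (λ ρ → size (S ψ ρ)))
      ≡⟨ cong (j *_) (∑-cong (vecs N r) (λ ψ → ∑-insertAt cs _)) ⟨
    j * count E A ∎

  rhs : ∑ (vecs N r) (λ ψ → ∑ (vecs N c) (λ ρ → pairs ψ ρ + k * (j * j)))
        ≡ count E A′ + N ^ r * (N ^ c * (k * (j * j)))
  rhs = begin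
    ∑ (vecs N r) (λ ψ → ∑ (vecs N c) (λ ρ → pairs ψ ρ + k * (j * j)))
      ≡⟨ ∑-cong (vecs N r) (λ ψ → trans (∑-distrib-+ (vecs N c) _ _)
                                        (cong (∑ (vecs N c) (pairs ψ) +_) (∑-vecs-const N c _))) ⟩
    ∑ (vecs N r) (λ ψ → ∑ (vecs N c) (pairs ψ) + N ^ c * (k * (j * j)))
      ≡⟨ trans (∑-distrib-+ (vecs N r) _ _)
              (cong (∑ (vecs N r) (λ ψ → ∑ (vecs N c) (pairs ψ)) +_) (∑-vecs-const N r _)) ⟩
    ∑ (vecs N r) (λ ψ → ∑ (vecs N c) (pairs ψ)) + N ^ r * (N ^ c * (k * (j * j)))
      -- The new last column is split off first and then `cs`, which leaves the double sum over `u`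
      -- and `v` in `pairs`.
      ≡⟨ cong (_+ _) (∑-cong (vecs N r) (λ ψ →
           trans (∑-insertAt (fromℕ (suc c)) (λ φ → [ does (isEmbedding? E A′ φ ψ) ])) (∑-insertAt cs _))) ⟨
    count E A′ + N ^ r * (N ^ c * (k * (j * j))) ∎

-- Average numbers of completions, for columns and by transposition for rows

rowBridgeAdj≡colBridgeAdjᵀ : ∀ (A : Adj c r) rs x a y a′ y′ →
  rowBridgeAdj A rs x a y a′ y′ ≡ colBridgeAdj (A ᵀ) rs x y a y′ a′
rowBridgeAdj≡colBridgeAdjᵀ A rs x a y a′ y′ with fromLast y | fromLast y′
... | just _  | just _  = refl
... | just _  | nothing = refl
... | nothing | just _  = refl
... | nothing | nothing = refl

-- With 2kj at most the average number Ne / X of completions, the loss k j² is at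
-- most half of the gain.
halve : ∀ {N e e′ Y} j k X → N * Y ≡ k * (j * j) * X → j * e ≤ e′ + Y →
        2 * (k * j) * X ≤ N * e → k * (j * j) * X ≤ N * e′
halve {N} {e} {e′} {Y} j k X NY≡ je≤ dense = +-cancelʳ-≤ (k * (j * j) * X) _ _ (begin
  k * (j * j) * X + k * (j * j) * X  ≡⟨ double k j X ⟩
  j * (2 * (k * j) * X)              ≤⟨ *-monoʳ-≤ j dense ⟩
  j * (N * e)                        ≡⟨ exchange j N e ⟩
  N * (j * e)                        ≤⟨ *-monoʳ-≤ N je≤ ⟩
  N * (e′ + Y)                       ≡⟨ *-distribˡ-+ N e′ Y ⟩
  N * e′ + N * Y                     ≡⟨ cong (N * e′ +_) NY≡ ⟩
  N * e′ + k * (j * j) * X           ∎)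
  where
  open ≤-Reasoning
  double : ∀ k j X → k * (j * j) * X + k * (j * j) * X ≡ j * (2 * (k * j) * X)
  double = solve-∀
  exchange : ∀ a b d → a * (b * d) ≡ b * (a * d)
  exchange = solve-∀

-- The ratio of `N * count` to `N ^ r * N ^ c` is the average number of completions when one column
-- is left free; multiplying by `N` avoids the exponent `c - 1`.
dense-colBridge : ∀ (G : GridGraph N N) k j (A : Adj c r) cs y →
  2 * (k * j) * (N ^ r * N ^ c) ≤ N * count (adj G) A →
  HasCoclique G k ⊎ k * (j * j) * (N ^ r * N ^ c) ≤ N * count (adj G) (colBridgeAdj A cs y)
dense-colBridge {N} {suc c} {r} G k j A cs y dense
  with count-colBridge (adj G) (adj-sym G) (adj-loop G) k j A cs y
... | inj₁ coclique = inj₁ (inj₁ coclique)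
... | inj₂ bound    = inj₂ (halve {N} j k _ (rearrange N (N ^ r) (N ^ c) (k * (j * j))) bound dense)
  where
  rearrange : ∀ N R C z → N * (R * (C * z)) ≡ z * (R * (N * C))
  rearrange = solve-∀

dense-rowBridge : ∀ (G : GridGraph N N) k j (A : Adj c r) rs x →
  2 * (k * j) * (N ^ r * N ^ c) ≤ N * count (adj G) A →
  HasCoclique G k ⊎ k * (j * j) * (N ^ r * N ^ c) ≤ N * count (adj G) (rowBridgeAdj A rs x)
dense-rowBridge {N} {c} {suc r} G k j A rs x dense
  with count-colBridge (adj G ᵀ) (λ y x y′ x′ → adj-sym G x y x′ y′) (λ y x → adj-loop G x y)
                       k j (A ᵀ) rs x
-- A row coclique of the transposed graph is by definition a column coclique of `G`.
... | inj₁ coclique = inj₁ (inj₂ coclique)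
... | inj₂ bound    = inj₂ (halve {N} j k _ (rearrange N (N ^ r) (N ^ c) (k * (j * j)))
    (≤-trans (*-monoʳ-≤ j (count-ᵀ (adj G) A)) (≤-trans bound (+-monoˡ-≤ _ untransposed))) dense)
  where
  rearrange : ∀ N R C z → N * (C * (R * z)) ≡ z * (N * R * C)
  rearrange = solve-∀
  untransposed : count (adj G ᵀ) (colBridgeAdj (A ᵀ) rs x) ≤ count (adj G) (rowBridgeAdj A rs x)
  untransposed = ≤-trans (count-ᵀ (adj G ᵀ) (colBridgeAdj (A ᵀ) rs x))
    (count-mono (adj G) λ a y a′ y′ → trans (sym (rowBridgeAdj≡colBridgeAdjᵀ A rs x a y a′ y′)))

-- Iterated bridging

-- The embedding density stays at least `(4 * k)` to the power `- loss B`: passing from δ to δ² / 4k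
-- doubles the exponent and adds one.
loss : Bridged c r → ℕ
loss single        = 0
loss (colBr B _ _) = suc (loss B + loss B)
loss (rowBr B _ _) = suc (loss B + loss B)

-- Here `w` is the loss before the bridging and `a` the exponent of `4 * k` still available after
-- it. `P` and `step` are abstract so that columns and rows share the computation.
bridge-density : ∀ {P : Set} {e e′} k L a w X → N ≡ (4 * k) ^ L → a + suc (w + w) ≡ L →
  (∀ j → 2 * (k * j) * X ≤ N * e → P ⊎ k * (j * j) * X ≤ N * e′) →
  P ⊎ (4 * k) ^ suc (a + w) * X ≤ N * e → P ⊎ (4 * k) ^ a * (N * X) ≤ N * e′
bridge-density k L a w X N≡ L≡ step (inj₁ p)      = inj₁ p
bridge-density {N} k L a w X N≡ L≡ step (inj₂ dense) =
  -- The average before is `4 * k * Q`, and dividing it by `2 * k` gives `j = 2 * Q`.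
  map₂ (≤-trans (≤-reflexive after)) (step (2 * Q) (≤-trans (≤-reflexive (before k Q X)) dense))
  where
  Q = (4 * k) ^ (a + w)

  before : ∀ k Q X → 2 * (k * (2 * Q)) * X ≡ 4 * k * Q * X
  before = solve-∀

  square : ∀ k Q X → 4 * k * (Q * Q) * X ≡ k * (2 * Q * (2 * Q)) * X
  square = solve-∀

  exponent : ∀ a w → a + (a + suc (w + w)) ≡ suc ((a + w) + (a + w))
  exponent = solve-∀

  open ≡-Reasoning
  after : (4 * k) ^ a * (N * X) ≡ k * (2 * Q * (2 * Q)) * X
  after = begin
    (4 * k) ^ a * (N * X)                          ≡⟨ *-assoc ((4 * k) ^ a) N X ⟨
    (4 * k) ^ a * N * X                            ≡⟨ cong (λ n → (4 * k) ^ a * n * X) N≡ ⟩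
    (4 * k) ^ a * (4 * k) ^ L * X                  ≡⟨ cong (_* X) (^-distribˡ-+-* (4 * k) a L) ⟨
    (4 * k) ^ (a + L) * X                          ≡⟨ cong (λ l → (4 * k) ^ (a + l) * X) L≡ ⟨
    (4 * k) ^ (a + (a + suc (w + w))) * X          ≡⟨ cong (λ l → (4 * k) ^ l * X) (exponent a w) ⟩
    4 * k * (4 * k) ^ ((a + w) + (a + w)) * X      ≡⟨ cong (λ z → 4 * k * z * X) (^-distribˡ-+-* (4 * k) (a + w) (a + w)) ⟩
    4 * k * (Q * Q) * X                            ≡⟨ square k Q X ⟩
    k * (2 * Q * (2 * Q)) * X                      ∎

shift : ∀ a w → suc (a + w) + w ≡ a + suc (w + w)
shift = solve-∀

-- The slack `a` stands for `L - loss B`: the average number of completions is at least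
-- `(4 * k) ^ a`. Each recursive call asks for the larger slack that the bridging will consume.
dense : ∀ k L → N ≡ (4 * k) ^ L → ∀ (G : GridGraph N N) (B : Bridged c r) a → a + loss B ≡ L →
        HasCoclique G k ⊎ (4 * k) ^ a * (N ^ r * N ^ c) ≤ N * count (adj G) (bAdj B)
-- With loss 0 the slack is all of `L`, and every placement of a single vertex is an embedding.
dense {N} k L N≡ G single a a≡L = inj₂ (*-mono-≤ (≤-reflexive q^a≡N) (≤-reflexive total))
  where
  q^a≡N : (4 * k) ^ a ≡ N
  q^a≡N = trans (cong ((4 * k) ^_) (trans (sym (+-identityʳ a)) a≡L)) (sym N≡)
  distinct₁ : (φ : Vec (Fin N) 1) → Distinct φ
  distinct₁ φ zero zero _ = refl
  total : N ^ 1 * N ^ 1 ≡ count (adj G) (bAdj single)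
  total = sym (begin
    count (adj G) (bAdj single)
      ≡⟨ ∑-cong (vecs N 1) (λ ψ → ∑-cong (vecs N 1) (λ φ →
           cong [_] (dec-true (isEmbedding? (adj G) (bAdj single) φ ψ)
                              (distinct₁ φ , distinct₁ ψ , λ _ _ _ _ ())))) ⟩
    ∑ (vecs N 1) (λ _ → ∑ (vecs N 1) (λ _ → 1))
      ≡⟨ trans (∑-vecs-const N 1 _) (cong (N ^ 1 *_) (trans (∑-vecs-const N 1 1) (*-identityʳ (N ^ 1)))) ⟩
    N ^ 1 * N ^ 1 ∎)
    where open ≡-Reasoning
dense {N} k L N≡ G (colBr {c} {r} B cs y) a L≡ =
  map₂ (≤-trans (≤-reflexive (cong ((4 * k) ^ a *_) (rearrange N (N ^ r) (N ^ c)))))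
    (bridge-density k L a (loss B) (N ^ r * N ^ c) N≡ L≡
      (λ j → dense-colBridge G k j (bAdj B) cs y)
      (dense k L N≡ G B (suc (a + loss B)) (trans (shift a (loss B)) L≡)))
  where
  rearrange : ∀ N R C → R * (N * C) ≡ N * (R * C)
  rearrange = solve-∀
dense {N} k L N≡ G (rowBr {c} {r} B rs x) a L≡ =
  map₂ (≤-trans (≤-reflexive (cong ((4 * k) ^ a *_) (*-assoc N (N ^ r) (N ^ c)))))
    (bridge-density k L a (loss B) (N ^ r * N ^ c) N≡ L≡
      (λ j → dense-rowBridge G k j (bAdj B) rs x)
      (dense k L N≡ G B (suc (a + loss B)) (trans (shift a (loss B)) L≡)))

-- From a positive count to the Ramsey property

count-positive⇒contains : ∀ (H : GridGraph c r) (B : Bridged c r) σ τ → RelabelOf H B σ τ →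
  ∀ (G : GridGraph N N) → 0 < count (adj G) (bAdj B) → Contains G H
count-positive⇒contains H B σ τ relabel G 0<count
  with count-positive (adj G) (bAdj B) 0<count
... | φ , ψ , φ-dist , ψ-dist , φψ-edges = record
  { φc     = λ x → lookup φ (σ ⟨$⟩ʳ x)
  ; φr     = λ y → lookup ψ (τ ⟨$⟩ʳ y)
  ; φc-inj = λ eq → Injection.injective (↔⇒↣ σ) (φ-dist _ _ eq)
  ; φr-inj = λ eq → Injection.injective (↔⇒↣ τ) (ψ-dist _ _ eq)
  ; edges  = λ x y x′ y′ e → φψ-edges _ _ _ _ (trans (sym (relabel x y x′ y′)) e)
  }

-- `B′` arises from `B` by the last bridging, given only through `step`. The exponent `suc (loss B)`
-- leaves `B` slack 1, that is an average of at least `4 * k` completions.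
grProperty-bridge : ∀ (H : GridGraph m n) (B′ : Bridged m n) σ τ → RelabelOf H B′ σ τ →
  ∀ k → 1 ≤ k → (B : Bridged c r) →
  (∀ {N} (G : GridGraph N N) j → 2 * (k * j) * (N ^ r * N ^ c) ≤ N * count (adj G) (bAdj B) →
    HasCoclique G k ⊎ k * (j * j) * (N ^ r * N ^ c) ≤ N * count (adj G) (bAdj B′)) →
  GrProperty H k ((4 * k) ^ suc (loss B))
grProperty-bridge {c = c} {r} H B′ σ τ relabel k@(suc _) _ B step G =
  [ inj₂ , [ inj₂ , inj₁ ∘ count-positive⇒contains H B′ σ τ relabel G ∘ positive ]′ ∘ last ]′
    (dense k L refl G B 1 refl)
  where
  L = suc (loss B)
  N₀ = (4 * k) ^ L
  X = N₀ ^ r * N₀ ^ c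

  instance
    N₀≢0 : NonZero N₀
    N₀≢0 = m^n≢0 (4 * k) L

  0<X : 0 < X
  0<X = *-mono-≤ (m^n>0 N₀ r) (m^n>0 N₀ c)

  simplify : ∀ k X → 2 * (k * 2) * X ≡ 4 * k * 1 * X
  simplify = solve-∀

  last : (4 * k) ^ 1 * X ≤ N₀ * count (adj G) (bAdj B) →
         HasCoclique G k ⊎ k * 4 * X ≤ N₀ * count (adj G) (bAdj B′)
  -- The choice `j = 2` makes the required average `2 * (k * j)` equal to `4 * k`.
  last many = step G 2 (≤-trans (≤-reflexive (simplify k X)) many)

  positive : ∀ {e} → k * 4 * X ≤ N₀ * e → 0 < e
  positive {suc e} _ = s≤s z≤n
  positive {zero}  p =
    contradiction (≤-trans (*-mono-≤ {1} {k * 4} (s≤s z≤n) 0<X) (≤-trans p (≤-reflexive (*-zeroʳ N₀)))) λ ()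

-- The bound

^-distribʳ-* : ∀ a b n → (a * b) ^ n ≡ a ^ n * b ^ n
^-distribʳ-* a b zero    = refl
^-distribʳ-* a b (suc n) rewrite ^-distribʳ-* a b n = interchange a b (a ^ n) (b ^ n)
  where
  interchange : ∀ a b c d → a * b * (c * d) ≡ a * c * (b * d)
  interchange = solve-∀

suc-loss : ∀ w → suc (suc (w + w)) ≡ 2 * suc w
suc-loss = solve-∀

-- Here `n` is the number of bridgings: each adds one to `r + c` and doubles `suc (loss B)`.
loss-dimensions : (B : Bridged c r) → ∃[ n ] (r + c ≡ 2 + n × suc (loss B) ≡ 2 ^ n)
loss-dimensions single = 0 , refl , refl
loss-dimensions (colBr {c} {r} B _ _) with loss-dimensions B
... | n , dim , eq = suc n , trans (+-suc r c) (cong suc dim) , trans (suc-loss (loss B)) (cong (2 *_) eq)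
loss-dimensions (rowBr {c} {r} B _ _) with loss-dimensions B
... | n , dim , eq = suc n , cong suc dim , trans (suc-loss (loss B)) (cong (2 *_) eq)

-- Squares are compared because the exponent `2 ^ (r + c - 3)` of the final bound is 1/2 for a
-- single vertex. The sizes here are those before the last bridging, hence `suc (r + c)`.
bridge-bound : ∀ k (B : Bridged c r) →
  (4 * k) ^ suc (loss B) * (4 * k) ^ suc (loss B) ≤
  2 ^ (2 * (2 ^ suc (r + c) ∸ 2)) * k ^ (2 ^ (suc (r + c) ∸ 2))
bridge-bound {c} {r} k B with loss-dimensions B
... | n , dim , eq rewrite dim = begin
  (4 * k) ^ suc (loss B) * (4 * k) ^ suc (loss B)
                                             ≡⟨ cong (λ l → (4 * k) ^ l * (4 * k) ^ l) eq ⟩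
  (4 * k) ^ 2 ^ n * (4 * k) ^ 2 ^ n          ≡⟨ ^-distribˡ-+-* (4 * k) (2 ^ n) (2 ^ n) ⟨
  (4 * k) ^ (2 ^ n + 2 ^ n)                  ≡⟨ cong (λ l → (4 * k) ^ (2 ^ n + l)) (+-identityʳ (2 ^ n)) ⟨
  (4 * k) ^ M                                ≡⟨ ^-distribʳ-* 4 k M ⟩
  4 ^ M * k ^ M                              ≡⟨ cong (_* k ^ M) (^-*-assoc 2 2 M) ⟩
  -- The power of `k` is already exact; only the power of 2 is enlarged.
  2 ^ (2 * M) * k ^ M                        ≤⟨ *-monoˡ-≤ (k ^ M) (^-monoʳ-≤ 2 (*-monoʳ-≤ 2 M≤)) ⟩
  2 ^ (2 * (2 ^ (3 + n) ∸ 2)) * k ^ M        ∎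
  where
  open ≤-Reasoning
  M = 2 ^ suc n
  M+M≤ : ∀ M → M + M ≤ 2 * (2 * M)
  M+M≤ M = ≤-trans (m≤m+n (M + M) (M + M)) (≤-reflexive (quadruple M))
    where
    quadruple : ∀ M → M + M + (M + M) ≡ 2 * (2 * M)
    quadruple = solve-∀
  M≤ : M ≤ 2 ^ (3 + n) ∸ 2
  M≤ = m+n≤o⇒m≤o∸n M (≤-trans (+-monoʳ-≤ M (*-monoʳ-≤ 2 (m^n>0 2 n))) (M+M≤ M))

theorem3p3 : ∀ {c r} (H : GridGraph c r) (B : Bridged c r)
    (σ : Permutation′ c) (τ : Permutation′ r) →
    RelabelOf H B σ τ →
    ∀ (k : ℕ) → 1 ≤ k →
    ∃[ N ] (N * N ≤ 2 ^ (2 * (2 ^ (r + c) ∸ 2)) * k ^ (2 ^ (r + c ∸ 2))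
    × GrProperty H k N)
-- For `r + c = 2` the bound is `16 * k`, and the edgeless `H` embeds by the identity.
theorem3p3 H single σ τ relabel k 1≤k = 1 , *-mono-≤ {1} {16} (s≤s z≤n) (*-mono-≤ 1≤k (s≤s z≤n)) , λ G →
  inj₁ record
    { φc     = id
    ; φr     = id
    ; φc-inj = id
    ; φr-inj = id
    ; edges  = λ x y x′ y′ e → contradiction (trans (sym (relabel x y x′ y′)) e) λ ()
    }
-- The sum `r + suc c` has to be rewritten to the form in `bridge-bound`; in the row case
-- `suc r + c` computes to it.
theorem3p3 H B′@(colBr {c} {r} B cs y) σ τ relabel k 1≤k rewrite +-suc r c =
  (4 * k) ^ suc (loss B) , bridge-bound k B ,
  grProperty-bridge H B′ σ τ relabel k 1≤k B (λ G j → dense-colBridge G k j (bAdj B) cs y)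
theorem3p3 H B′@(rowBr B rs x) σ τ relabel k 1≤k =
  (4 * k) ^ suc (loss B) , bridge-bound k B ,
  grProperty-bridge H B′ σ τ relabel k 1≤k B (λ G j → dense-rowBridge G k j (bAdj B) rs x)
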